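{- If $G$ is a wheel-free graph on at least two vertices that contains no subdivision of $K_{3,3}$ (as a subgraph), then $G$ has at least two vertices of degree at most $2$.
   Context: Graphs are finite, simple and undirected. A graph $G$ is wheel-free if it contains no wheel as a subgraph, i.e. there is no cycle $C$ of $G$ (as a subgraph, not necessarily induced) and vertex $v\in V(G)\setminus V(C)$ such that $v$ has at least three neighbors in $V(C)$. -}

module Defs where

open import Level using (0ℓ)
open import Data.Bool using (Bool; true; false)
open import Data.Bool.Properties using () renaming (_≟_ to _≟ᵇ_)
open import Data.Fin using (Fin; _<_; splitAt)
open import Data.List using (List; _∷_; [_]; _++_; length; filter; allFin)
open import Data.List.Membership.Propositional using (_∉_)
open import Data.List.Relation.Binary.Disjoint.Propositional using (Disjoint)
open import Data.List.Relation.Unary.Linked using (Linked)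
open import Data.List.Relation.Unary.Unique.Propositional using (Unique)
open import Data.Nat using (ℕ; _+_; _≤_)
open import Data.Product using (∃-syntax; _×_; _,_)
open import Data.Sum using ([_,_]′)
open import Function using (_∘_; const)
open import Function.Definitions using (Injective)
open import Relation.Binary using (Rel; Symmetric; Irreflexive; Decidable)
open import Relation.Binary.PropositionalEquality using (_≡_; _≢_; refl; ≢-sym)
open import Relation.Nullary using (¬_)
open import Relation.Nullary.Decidable using (¬?)

-- A finite simple undirected graph with vertex set Fin n.
record Graph (n : ℕ) : Set₁ where
  field
    Adj    : Rel (Fin n) 0ℓ
    adj?   : Decidable Adj
    sym    : Symmetric Adj
    irrefl : Irreflexive _≡_ Adj

  -- Counted with multiplicity in the list; used only for duplicate-free lists.
  #neighboursIn : Fin n → List (Fin n) → ℕ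
  #neighboursIn v xs = length (filter (adj? v) xs)

  degree : Fin n → ℕ
  degree v = #neighboursIn v (allFin n)

  -- Each edge of the graph is represented once, by its increasing orientation.
  Edge : Rel (Fin n) 0ℓ
  Edge u v = u < v × Adj u v

  IsPath : List (Fin n) → Set
  IsPath xs = Unique xs × Linked Adj xs

  -- The vertices x ∷ xs in cyclic order; the final  [ x ]  closes the cycle up.
  IsCycle : Fin n → List (Fin n) → Set
  IsCycle x xs = 3 ≤ length (x ∷ xs) × Unique (x ∷ xs) × Linked Adj (x ∷ xs ++ [ x ])

  IsWheel : Fin n → Fin n → List (Fin n) → Set
  IsWheel v x xs = IsCycle x xs × v ∉ x ∷ xs × 3 ≤ #neighboursIn v (x ∷ xs)

  WheelFree : Set
  WheelFree = ¬ (∃[ v ] ∃[ x ] ∃[ xs ] IsWheel v x xs)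

-- A subgraph of G that is a subdivision of H: every edge uv of H is replaced
-- by a path of G from branch u to branch v, whose (possibly empty) list of
-- inner vertices avoids all branch vertices and all the other paths.
-- The values of  inner u v  are irrelevant when (u , v) is not an Edge of H.
record Subdivision {m n : ℕ} (H : Graph m) (G : Graph n) : Set where
  private
    module H = Graph H
    module G = Graph G
  field
    branch           : Fin m → Fin n
    branch-injective : Injective _≡_ _≡_ branch
    inner            : Fin m → Fin m → List (Fin n)
    isPath           : ∀ {u v} → H.Edge u v →
                       G.IsPath (branch u ∷ inner u v ++ [ branch v ])
    inner-not-branch : ∀ {u v} → H.Edge u v → ∀ w → branch w ∉ inner u v
    inner-disjoint   : ∀ {u v u′ v′} → H.Edge u v → H.Edge u′ v′ →
                       (u , v) ≢ (u′ , v′) → Disjoint (inner u v) (inner u′ v′)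

-- Which of the two classes a vertex of K a b belongs to.
side : ∀ a {b} → Fin (a + b) → Bool
side a = [ const false , const true ]′ ∘ splitAt a

-- The complete bipartite graph.
K : ∀ a b → Graph (a + b)
K a b = record
  { Adj    = λ i j → side a i ≢ side a j
  ; adj?   = λ i j → ¬? (side a i ≟ᵇ side a j)
  ; sym    = ≢-sym
  ; irrefl = λ { refl i≢i → i≢i refl }
  }

{-# OPTIONS --safe #-}

-- For a contradiction suppose that all vertices other than z have degree at
-- least 3. Take a smallest nonempty D₁ avoiding z with at most one outer
-- neighbour t, an edge tt′ with t′ in D₁, and a smallest nonempty D inside
-- D₁ - t′ with at most two outer neighbours. Uncrossing D with the sides of
-- a hypothetical cutvertex shows that, for every v in D, removing v from D₁
-- + t leaves a 2-connected graph J; it contains at least three neighbours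
-- a, b, c of v. By 2-connectedness J has a cycle C through a and b, and, if
-- c is not on C, a path M through c with distinct ends p, q on C and
-- otherwise disjoint from C. If p and q separate a from b on C, then v, p,
-- q and a, b, c are the branch vertices of a subdivision of K₃,₃; otherwise
-- M and one of the arcs of C form a cycle through a, b and c, the rim of a
-- wheel with hub v.
module Submission where

open import Defs
import Algebra.Solver.CommutativeMonoid as Solver
open import Data.Bool using (true; false)
open import Data.Empty using (⊥; ⊥-elim)
open import Data.Fin using (Fin; zero; suc; _≟_; _↑ˡ_; _↑ʳ_; splitAt; combine)
open import Data.Fin.Patterns
open import Data.Fin.Properties
  using (sequence; any?; ↑ˡ-injective; ↑ʳ-injective; splitAt-↑ˡ; splitAt-↑ʳ; splitAt⁻¹-↑ˡ;
         splitAt⁻¹-↑ʳ; combine-injective; toℕ-↑ˡ; toℕ-↑ʳ; toℕ<n)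
open import Data.Fin.Subset
  using (Subset; Nonempty; ⊤; ⁅_⁆; _∪_; _∩_; _-_; _⊂_; _⊆_)
  renaming (_∈_ to _∈ˢ_; _∉_ to _∉ˢ_)
open import Data.Fin.Subset.Induction using (⊂-wellFounded; Acc; acc)
open import Data.Fin.Subset.Properties
  using (∈⊤; x∈⁅x⁆; x∈⁅y⁆⇒x≡y; x∈p∩q⁺; x∈p∩q⁻; x∈p∪q⁺; x∈p∪q⁻; p─q⊆p; x∈p∧x≢y⇒x∈p-y;
         x∈p⇒p-x⊂p)
  renaming (_∈?_ to _∈ˢ?_)
open import Data.List as List
  using (List; []; _∷_; [_]; _++_; length; filter; concat; allFin)
open import Data.List.Membership.DecPropositional using () renaming (_∈?_ to member?)
open import Data.List.Membership.Propositional using (_∈_; _∉_)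
open import Data.List.Membership.Propositional.Properties
  using (∈-∃++; ∈-++⁺ˡ; ∈-++⁺ʳ; ∈-++⁻; ∈-insert; ∈-filter⁺; ∈-filter⁻; ∈-concat⁺′; ∈-lookup)
open import Data.List.Properties using (++-assoc; length-filter)
open import Data.List.Relation.Binary.Disjoint.Propositional using (Disjoint)
open import Data.List.Relation.Binary.Permutation.Propositional
  using (_↭_; prep; ↭-refl; ↭-sym; ↭-trans; ↭-reflexive; ↭⇒↭ₛ)
open import Data.List.Relation.Binary.Permutation.Propositional.Properties
  using (∈-resp-↭; All-resp-↭; shift; shifts; ++-comm; ++⁺; ++⁺ˡ; ++⁺ʳ; ↭-length;
         ++-commutativeMonoid)
import Data.List.Relation.Binary.Permutation.Setoid.Properties as Permutation
open import Data.List.Relation.Unary.All as All using (All; []; _∷_; lookup)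
open import Data.List.Relation.Unary.All.Properties
  using (¬Any⇒All¬; All¬⇒¬Any)
  renaming (++⁺ to All-++⁺; ++⁻ˡ to All-++⁻ˡ; ++⁻ʳ to All-++⁻ʳ)
open import Data.List.Relation.Unary.AllPairs using ([]; _∷_)
open import Data.List.Relation.Unary.Any using (here; there)
open import Data.List.Relation.Unary.Linked using (Linked; [-]; _∷_)
open import Data.List.Relation.Unary.Unique.Propositional using (Unique)
open import Data.List.Relation.Unary.Unique.Propositional.Properties
  using (Unique[x∷xs]⇒x∉xs; allFin⁺; filter⁺) renaming (++⁺ to Unique-++⁺)
open import Data.Nat as ℕ using (ℕ; suc; _≤_; z≤n; s≤s)
open import Data.Nat.Properties
  using (≤-trans; ≤-reflexive; m≤m+n; <⇒≯; <-≤-trans; ≰⇒>; _≤?_)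
open import Data.Product using (∃₂; ∃-syntax; _×_; _,_; proj₁; proj₂)
open import Data.Sum using (_⊎_; inj₁; inj₂; [_,_]′; swap)
open import Data.Vec as Vec using (_∷_; []; there)
open import Data.Vec.Properties using ([]=⇒lookup; lookup⇒[]=; lookup∘tabulate)
open import Effect.Monad using (RawMonad)
open import Function using (_∘_; id)
open import Relation.Binary.Construct.Closure.ReflexiveTransitive using (Star; ε; _◅_; _◅◅_)
open import Relation.Binary.PropositionalEquality
  using (_≡_; _≢_; refl; sym; trans; cong; subst; subst₂; ≢-sym; setoid)
open import Relation.Nullary using (¬_; Dec; yes; no; does; contradiction)
open import Relation.Nullary.Decidable
  using (¬¬-excluded-middle; _×-dec_; ¬?; dec-true; decidable-stable)
open import Relation.Nullary.Negation using (¬¬-Monad)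
open import Relation.Unary using (Decidable)

private variable
  A : Set
  n : ℕ

-- Subsets of vertices, under double negation.

-- Double negation commutes with finite conjunctions, so excluded middle may be assumed for `P` at
-- all vertices at once. This is how reachability becomes a subset.
comprehension : (P : Fin n → Set) →
                ¬ ¬ (∃[ S ] (∀ {x} → x ∈ˢ S → P x) × (∀ {x} → P x → x ∈ˢ S))
comprehension {n} P k =
  sequence (RawMonad.rawApplicative ¬¬-Monad) (λ x → ¬¬-excluded-middle {A = P x}) λ P? →
  k ( Vec.tabulate (does ∘ P?)
    , (λ {x} x∈ → sound (P? x) (trans (sym (lookup∘tabulate (does ∘ P?) x)) ([]=⇒lookup x∈)))
    , (λ {x} p → lookup⇒[]= x _ (trans (lookup∘tabulate (does ∘ P?) x) (dec-true (P? x) p))))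
  where
  sound : {A : Set} (a? : Dec A) → does a? ≡ true → A
  sound (yes a) _ = a

-- Descent along strict inclusion: `k` receives the current set, and any smaller set that refutes
-- its minimality is where the descent resumes.
minimal : (Q : Subset n → Set) {D : Subset n} → Q D →
          ¬ ¬ (∃[ E ] Q E × (∀ {F} → Q F → ¬ F ⊂ E))
minimal Q = go (⊂-wellFounded _)
  where
  go : ∀ {D} → Acc _⊂_ D → Q D → ¬ ¬ (∃[ E ] Q E × (∀ {F} → Q F → ¬ F ⊂ E))
  go (acc rs) q k = k (_ , q , λ q′ F⊂D → go (rs F⊂D) q′ k)

∈-minus⁻ : ∀ {p : Subset n} {x y} → x ∈ˢ p - y → x ∈ˢ p × x ≢ y
∈-minus⁻ {p = p} {x} {y} x∈ = p─q⊆p p ⁅ y ⁆ x∈ , λ { refl → x∉p-x p x x∈ }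
  where
  x∉p-x : ∀ {n} (p : Subset n) x → ¬ (x ∈ˢ p - x)
  x∉p-x (true ∷ p) zero ()
  x∉p-x (false ∷ p) zero ()
  x∉p-x (_ ∷ p) (suc x) (there x∈) = x∉p-x p x x∈

-- Walks, connectivity and outer neighbours.

module Walks (G : Graph n) where
  open Graph G

  Step : Subset n → Fin n → Fin n → Fin n → Set
  Step J w a b = Adj a b × b ∈ˢ J × b ≢ w

  -- The subgraph induced on J is connected and has no cutvertex.
  Biconnected : Subset n → Set
  Biconnected J = ∀ w {a b} → a ∈ˢ J → b ∈ˢ J → a ≢ w → b ≢ w → ¬ ¬ Star (Step J w) a b

  Branching : Fin n → Set
  Branching v = ∃[ a ] ∃[ b ] ∃[ c ]
    (a ≢ b × a ≢ c × b ≢ c) × Adj v a × Adj v b × Adj v c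

  avoiding : ∀ {v} → Branching v → ∀ x y → ∃[ s ] Adj v s × s ≢ x × s ≢ y
  avoiding (a , b , c , (a≢b , a≢c , b≢c) , va , vb , vc) x y
    with a ≟ x | a ≟ y | b ≟ x | b ≟ y
  ... | no a≢x | no a≢y | _ | _ = a , va , a≢x , a≢y
  ... | _ | _ | no b≢x | no b≢y = b , vb , b≢x , b≢y
  ... | yes refl | _ | yes refl | _ = contradiction refl a≢b
  ... | yes refl | _ | _ | yes refl = c , vc , ≢-sym a≢c , ≢-sym b≢c
  ... | _ | yes refl | yes refl | _ = c , vc , ≢-sym b≢c , ≢-sym a≢c
  ... | _ | yes refl | _ | yes refl = contradiction refl a≢b

  -- Taking `x` and `y` equal expresses that there is at most one outer neighbour, so one definition
  -- serves both minimal choices.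
  Bounded : Subset n → Fin n → Fin n → Set
  Bounded D x y = ∀ {u w} → u ∈ˢ D → Adj u w → w ∉ˢ D → w ≡ x ⊎ w ≡ y

  -- Minimal sets with few outer neighbours.

  module _ {z} (branching : ∀ {u} → u ≢ z → Branching u) where

    Part : Subset n → Set
    Part D = Nonempty D × z ∉ˢ D × ∃[ t ] Bounded D t t

    module Block {D₁} (part : Part D₁) (min₁ : ∀ {F} → Part F → ¬ F ⊂ D₁) where

      t : Fin n
      t = proj₁ (proj₂ (proj₂ part))

      bounded₁ : ∀ {u w} → u ∈ˢ D₁ → Adj u w → w ∈ˢ D₁ ⊎ w ≡ t
      bounded₁ {w = w} u∈ uw with w ∈ˢ? D₁
      ... | yes w∈ = inj₁ w∈
      ... | no w∉ = inj₂ ([ id , id ]′ (proj₂ (proj₂ (proj₂ part)) u∈ uw w∉))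

      branching₁ : ∀ {u} → u ∈ˢ D₁ → Branching u
      branching₁ u∈ = branching λ { refl → proj₁ (proj₂ part) u∈ }

      neighbour₁ : ∀ {d} → d ∈ˢ D₁ → ∃[ s ] Adj d s × s ∈ˢ D₁
      neighbour₁ d∈ with avoiding (branching₁ d∈) t t
      ... | s , ds , s≢t , _ = s , ds , [ id , (λ s≡t → contradiction s≡t s≢t) ]′ (bounded₁ d∈ ds)

      adj≢ : ∀ {u w} → Adj u w → w ≢ u
      adj≢ uw refl = irrefl refl uw

      -- Otherwise `D₁ - d` would be a smaller `Part`: only `d` can be an outer neighbour of it, and
      -- it contains a neighbour of `d`.
      not-closed : ∀ {d} → d ∈ˢ D₁ → ¬ (∀ {u w} → u ∈ˢ D₁ → Adj u w → w ∈ˢ D₁)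
      not-closed {d} d∈ closed with neighbour₁ d∈
      ... | s , ds , s∈ = min₁
        ( (s , x∈p∧x≢y⇒x∈p-y s∈ (adj≢ ds))
        , (λ z∈ → proj₁ (proj₂ part) (proj₁ (∈-minus⁻ z∈)))
        , d , bounded)
        (x∈p⇒p-x⊂p d∈)
        where
        bounded : Bounded (D₁ - d) d d
        bounded {w = w} u∈ uw w∉ with w ≟ d
        ... | yes w≡d = inj₁ w≡d
        ... | no w≢d = contradiction (x∈p∧x≢y⇒x∈p-y (closed (proj₁ (∈-minus⁻ u∈)) uw) w≢d) w∉

      anchor : ∃[ t′ ] t′ ∈ˢ D₁ × Adj t t′
      anchor with any? (λ s → s ∈ˢ? D₁ ×-dec adj? t s)
      ... | yes t′ = t′
      ... | no ¬t′ = ⊥-elim (not-closed (proj₂ (proj₁ part)) λ u∈ uw →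
              [ id , (λ { refl → contradiction (_ , u∈ , Graph.sym G uw) ¬t′ }) ]′ (bounded₁ u∈ uw))

      t′ : Fin n
      t′ = proj₁ anchor

      t′∈D₁ : t′ ∈ˢ D₁
      t′∈D₁ = proj₁ (proj₂ anchor)

      tt′ : Adj t t′
      tt′ = proj₂ (proj₂ anchor)

      -- Such a set would be a `Part` properly inside `D₁`, as it misses `t′`.
      end-free : ∀ {E s} → Nonempty E → E ⊆ D₁ - t′ → ¬ Bounded E s s
      end-free {E} {s} ne E⊆ bd = min₁
        (ne , (λ z∈ → proj₁ (proj₂ part) (proj₁ (∈-minus⁻ (E⊆ z∈)))) , s , bd)
        ( (λ x∈ → proj₁ (∈-minus⁻ (E⊆ x∈)))
        , t′ , t′∈D₁ , (λ t′∈ → proj₂ (∈-minus⁻ (E⊆ t′∈)) refl))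

      Lobe : Subset n → Set
      Lobe D = Nonempty D × D ⊆ D₁ - t′ × ∃[ x ] ∃[ y ] Bounded D x y

      lobe₀ : Lobe (D₁ - t′)
      lobe₀ with neighbour₁ t′∈D₁
      ... | s , t′s , s∈ = (s , x∈p∧x≢y⇒x∈p-y s∈ (adj≢ t′s)) , id , t , t′ , bounded
        where
        bounded : Bounded (D₁ - t′) t t′
        bounded {w = w} u∈ uw w∉ with bounded₁ (proj₁ (∈-minus⁻ u∈)) uw
        ... | inj₂ w≡t = inj₁ w≡t
        ... | inj₁ w∈ with w ≟ t′
        ...   | yes w≡t′ = inj₂ w≡t′
        ...   | no w≢t′ = contradiction (x∈p∧x≢y⇒x∈p-y w∈ w≢t′) w∉

      module InLobe {D} (lobe : Lobe D) (min₂ : ∀ {F} → Lobe F → ¬ F ⊂ D)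
                    {v} (v∈D : v ∈ˢ D) where

        D⊆ : D ⊆ D₁ - t′
        D⊆ = proj₁ (proj₂ lobe)

        smaller-free : ∀ {E a b} → Nonempty E → E ⊂ D → ¬ Bounded E a b
        smaller-free ne E⊂D bd = min₂ (ne , D⊆ ∘ proj₁ E⊂D , _ , _ , bd) E⊂D

        -- P is a side of the cutvertex w in D₁ + t - v.
        module Cut {P w} (P⊆ : P ⊆ D₁ - t′) (v∉P : v ∉ˢ P) (P-bounded : Bounded P v w) where

          P∩D⊂D : P ∩ D ⊂ D
          P∩D⊂D = proj₂ ∘ x∈p∩q⁻ P D , v , v∈D , λ v∈ → v∉P (proj₁ (x∈p∩q⁻ P D v∈))

          union-free : ∀ {s} → ¬ Bounded (P ∪ D) s s
          union-free = end-free (v , x∈p∪q⁺ (inj₂ v∈D)) ([ P⊆ , D⊆ ]′ ∘ x∈p∪q⁻ P D)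

          P-only : ∀ {u s} → u ∈ˢ P → Adj u s → s ∉ˢ P ∪ D → s ≡ w
          P-only u∈ us s∉ with P-bounded u∈ us (s∉ ∘ x∈p∪q⁺ ∘ inj₁)
          ... | inj₁ refl = contradiction (x∈p∪q⁺ (inj₂ v∈D)) s∉
          ... | inj₂ s≡w = s≡w

          -- If `P` and `D` meet, an edge from the intersection that stays in `P` cannot leave `D`,
          -- so `v` and `w` bound a smaller lobe. If they are disjoint, a neighbour of `v` in `P`
          -- would be `x` or `y`; hence there is none, and `w` alone bounds `P`.
          both-outside : ∀ {x y} → Bounded D x y → Nonempty P → x ∉ˢ P → y ∉ˢ P → ⊥
          both-outside {x} {y} D-bounded neP x∉P y∉P with any? (λ u → u ∈ˢ? (P ∩ D))
          ... | yes meet = smaller-free meet P∩D⊂D bounded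
            where
            bounded : Bounded (P ∩ D) v w
            bounded {u} {s} u∈ us s∉ with s ∈ˢ? P | x∈p∩q⁻ P D u∈
            ... | no s∉P | u∈P , _ = P-bounded u∈P us s∉P
            ... | yes s∈P | _ , u∈D with D-bounded u∈D us (λ s∈D → s∉ (x∈p∩q⁺ (s∈P , s∈D)))
            ...   | inj₁ refl = contradiction s∈P x∉P
            ...   | inj₂ refl = contradiction s∈P y∉P
          ... | no disjoint = end-free neP P⊆ bounded
            where
            bounded : Bounded P w w
            bounded {u} u∈ us s∉ with P-bounded u∈ us s∉
            ... | inj₂ s≡w = inj₁ s≡w
            ... | inj₁ refl
              with D-bounded v∈D (Graph.sym G us) (λ u∈D → disjoint (u , x∈p∩q⁺ (u∈ , u∈D)))
            ...   | inj₁ refl = contradiction u∈ x∉P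
            ...   | inj₂ refl = contradiction u∈ y∉P

          -- The union absorbs `x`, `y` and `v`, which leaves `w` as the only possible outer
          -- neighbour.
          both-inside : ∀ {x y} → Bounded D x y → x ∈ˢ P → y ∈ˢ P → ⊥
          both-inside D-bounded x∈P y∈P = union-free {w} bounded
            where
            bounded : Bounded (P ∪ D) w w
            bounded {u} u∈ us s∉ with x∈p∪q⁻ P D u∈
            ... | inj₁ u∈P = inj₁ (P-only u∈P us s∉)
            ... | inj₂ u∈D with D-bounded u∈D us (s∉ ∘ x∈p∪q⁺ ∘ inj₂)
            ...   | inj₁ refl = contradiction (x∈p∪q⁺ (inj₁ x∈P)) s∉
            ...   | inj₂ refl = contradiction (x∈p∪q⁺ (inj₁ y∈P)) s∉

          -- The union absorbs `x` and `v`. If it absorbs `w` too, or if `w` is `y`, only `y`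
          -- remains outside; otherwise a smaller lobe is found inside `D`.
          one-inside : ∀ {x y} → Bounded D x y → x ∈ˢ P → y ∉ˢ P → ⊥
          one-inside {x} {y} D-bounded x∈P y∉P with w ∈ˢ? D | w ≟ y
          ... | yes w∈D | _ = union-free {y} bounded
            where
            bounded : Bounded (P ∪ D) y y
            bounded u∈ us s∉ with x∈p∪q⁻ P D u∈
            ... | inj₁ u∈P with refl ← P-only u∈P us s∉ = contradiction (x∈p∪q⁺ (inj₂ w∈D)) s∉
            ... | inj₂ u∈D with D-bounded u∈D us (s∉ ∘ x∈p∪q⁺ ∘ inj₂)
            ...   | inj₁ refl = contradiction (x∈p∪q⁺ (inj₁ x∈P)) s∉
            ...   | inj₂ s≡y = inj₁ s≡y
          ... | no _ | yes refl = union-free {y} bounded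
            where
            bounded : Bounded (P ∪ D) y y
            bounded u∈ us s∉ with x∈p∪q⁻ P D u∈
            ... | inj₁ u∈P = inj₁ (P-only u∈P us s∉)
            ... | inj₂ u∈D with D-bounded u∈D us (s∉ ∘ x∈p∪q⁺ ∘ inj₂)
            ...   | inj₁ refl = contradiction (x∈p∪q⁺ (inj₁ x∈P)) s∉
            ...   | inj₂ s≡y = inj₁ s≡y
          ... | no w∉D | no w≢y with any? (λ u → u ∈ˢ? (P ∩ D))
          -- Since `w` lies outside `D` and differs from `y`, an edge from the intersection to `w`
          -- forces `w` to be `x`.
          ...   | yes meet = smaller-free meet P∩D⊂D bounded
            where
            bounded : Bounded (P ∩ D) v x
            bounded {u} {s} u∈ us s∉ with s ∈ˢ? P | s ∈ˢ? D | x∈p∩q⁻ P D u∈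
            ... | yes s∈P | yes s∈D | _ = contradiction (x∈p∩q⁺ (s∈P , s∈D)) s∉
            ... | yes s∈P | no s∉D | _ , u∈D with D-bounded u∈D us s∉D
            ...   | inj₁ s≡x = inj₂ s≡x
            ...   | inj₂ refl = contradiction s∈P y∉P
            bounded u∈ us s∉ | no s∉P | _ | u∈P , u∈D with P-bounded u∈P us s∉P
            ...   | inj₁ s≡v = inj₁ s≡v
            ...   | inj₂ refl with D-bounded u∈D us w∉D
            ...     | inj₁ s≡x = inj₂ s≡x
            ...     | inj₂ s≡y = contradiction s≡y w≢y
          -- A neighbour of `x` in `D` lies outside `P`, so it is `v` or `w`, and `w` is not in `D`.
          -- Hence `x` is not adjacent to `D - v`.
          one-inside {x} {y} D-bounded x∈P y∉P | no w∉D | no w≢y | no disjoint =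
            smaller-free remainder (x∈p⇒p-x⊂p v∈D) bounded
            where
            -- `v` has a neighbour other than `x` and `y`, and this cannot lie outside `D`.
            remainder : Nonempty (D - v)
            remainder with avoiding (branching₁ (proj₁ (∈-minus⁻ (D⊆ v∈D)))) x y
            ... | s , vs , s≢x , s≢y with s ∈ˢ? D
            ...   | yes s∈D = s , x∈p∧x≢y⇒x∈p-y s∈D (adj≢ vs)
            ...   | no s∉D = ⊥-elim ([ s≢x , s≢y ]′ (D-bounded v∈D vs s∉D))
            bounded : Bounded (D - v) v y
            bounded {u} {s} u∈ us s∉ with s ≟ v | ∈-minus⁻ u∈
            ... | yes s≡v | _ = inj₁ s≡v
            ... | no s≢v | u∈D , u≢v
              with D-bounded u∈D us (λ s∈D → s∉ (x∈p∧x≢y⇒x∈p-y s∈D s≢v))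
            ...   | inj₂ s≡y = inj₂ s≡y
            ...   | inj₁ refl
              with P-bounded x∈P (Graph.sym G us) (λ u∈P → disjoint (u , x∈p∩q⁺ (u∈P , u∈D)))
            ...     | inj₁ u≡v = contradiction u≡v u≢v
            ...     | inj₂ refl = contradiction u∈D w∉D

          impossible : ¬ Nonempty P
          impossible neP with proj₂ (proj₂ lobe)
          ... | x , y , D-bounded with x ∈ˢ? P | y ∈ˢ? P
          ...   | yes x∈P | yes y∈P = both-inside D-bounded x∈P y∈P
          ...   | yes x∈P | no y∉P = one-inside D-bounded x∈P y∉P
          ...   | no x∉P | yes y∈P = one-inside (λ u∈ us s∉ → swap (D-bounded u∈ us s∉)) y∈P x∉P
          ...   | no x∉P | no y∉P = both-outside D-bounded neP x∉P y∉P

        -- The 2-connected graph around `v`.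

        J : Subset n
        J = (D₁ ∪ ⁅ t ⁆) - v

        v∉J : v ∉ˢ J
        v∉J v∈ = proj₂ (∈-minus⁻ v∈) refl

        ∈J : ∀ {s} → s ∈ˢ D₁ ⊎ s ≡ t → s ≢ v → s ∈ˢ J
        ∈J (inj₁ s∈) = x∈p∧x≢y⇒x∈p-y (x∈p∪q⁺ (inj₁ s∈))
        ∈J (inj₂ refl) = x∈p∧x≢y⇒x∈p-y (x∈p∪q⁺ (inj₂ (x∈⁅x⁆ t)))

        ∈J⁻ : ∀ {s} → s ∈ˢ J → s ∈ˢ D₁ ⊎ s ≡ t
        ∈J⁻ s∈ with x∈p∪q⁻ D₁ ⁅ t ⁆ (proj₁ (∈-minus⁻ s∈))
        ... | inj₁ s∈D₁ = inj₁ s∈D₁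
        ... | inj₂ s∈t = inj₂ (x∈⁅y⁆⇒x≡y t s∈t)

        v∈D₁ : v ∈ˢ D₁
        v∈D₁ = proj₁ (∈-minus⁻ (D⊆ v∈D))

        neighbours∈J : ∀ {s} → Adj v s → s ∈ˢ J
        neighbours∈J vs = ∈J (bounded₁ v∈D₁ vs) (adj≢ vs)

        -- The edge tt′ meets at most one of two sides of a cutvertex, hence the
        -- other side lies in D₁ - t′.
        closed-meets-anchor : ∀ {P w} → P ⊆ J → Nonempty P →
          (∀ {u s} → u ∈ˢ P → Adj u s → s ∈ˢ J → s ≢ w → s ∈ˢ P) →
          ¬ (t ∉ˢ P × t′ ∉ˢ P)
        closed-meets-anchor {P} {w} P⊆J ne closed (t∉P , t′∉P) =
          Cut.impossible P⊆ (v∉J ∘ P⊆J) bounded ne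
          where
          P⊆D₁ : P ⊆ D₁
          P⊆D₁ s∈ = [ id , (λ { refl → contradiction s∈ t∉P }) ]′ (∈J⁻ (P⊆J s∈))
          P⊆ : P ⊆ D₁ - t′
          P⊆ s∈ = x∈p∧x≢y⇒x∈p-y (P⊆D₁ s∈) (λ { refl → t′∉P s∈ })
          bounded : Bounded P v w
          bounded {u} {s} u∈ us s∉ with s ≟ v | s ≟ w
          ... | yes s≡v | _ = inj₁ s≡v
          ... | no _ | yes s≡w = inj₂ s≡w
          ... | no s≢v | no s≢w =
            contradiction (closed u∈ us (∈J (bounded₁ (P⊆D₁ u∈) us) s≢v) s≢w) s∉

        -- Apart from `w`, the vertices of `J` split into those reached from `a` and the others.
        -- Each class would have to contain `t` or `t′`, but no edge joins the classes, so `t` and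
        -- `t′` cannot lie in different ones.
        J-biconnected : Biconnected J
        J-biconnected w {a} {b} a∈J b∈J a≢w b≢w a↛b =
          comprehension (λ s → (s ∈ˢ J × s ≢ w) × Star (Step J w) a s) λ (P , P⁻ , P⁺) →
          comprehension (λ s → (s ∈ˢ J × s ≢ w) × ¬ Star (Step J w) a s) λ (Q , Q⁻ , Q⁺) →
          let
            P-closed : ∀ {u s} → u ∈ˢ P → Adj u s → s ∈ˢ J → s ≢ w → s ∈ˢ P
            P-closed u∈ us s∈J s≢w =
              P⁺ ((s∈J , s≢w) , proj₂ (P⁻ u∈) ◅◅ ((us , s∈J , s≢w) ◅ ε))
            Q-closed : ∀ {u s} → u ∈ˢ Q → Adj u s → s ∈ˢ J → s ≢ w → s ∈ˢ Q
            Q-closed u∈ us s∈J s≢w =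
              Q⁺ ((s∈J , s≢w) , λ a→s →
                proj₂ (Q⁻ u∈) (a→s ◅◅ ((Graph.sym G us , proj₁ (Q⁻ u∈)) ◅ ε)))
            disjoint : ∀ {s} → s ∈ˢ P → s ∉ˢ Q
            disjoint s∈P s∈Q = proj₂ (Q⁻ s∈Q) (proj₂ (P⁻ s∈P))
            Q-meets : ¬ (t ∉ˢ Q × t′ ∉ˢ Q)
            Q-meets = closed-meets-anchor (proj₁ ∘ proj₁ ∘ Q⁻) (b , Q⁺ ((b∈J , b≢w) , a↛b)) Q-closed
            t∉P : t ∉ˢ P
            t∉P t∈P = let (t∈J , t≢w) = proj₁ (P⁻ t∈P) in
              Q-meets (disjoint t∈P , λ t′∈Q →
                disjoint t∈P (Q-closed t′∈Q (Graph.sym G tt′) t∈J t≢w))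
            t′∉P : t′ ∉ˢ P
            t′∉P t′∈P = let (t′∈J , t′≢w) = proj₁ (P⁻ t′∈P) in
              Q-meets ((λ t∈Q → disjoint t′∈P (Q-closed t∈Q tt′ t′∈J t′≢w)) , disjoint t′∈P)
          in closed-meets-anchor (proj₁ ∘ proj₁ ∘ P⁻) (a , P⁺ ((a∈J , a≢w) , ε)) P-closed
               (t∉P , t′∉P)

    biconnected-neighbourhood : ∀ {z′} → z′ ≢ z → ¬ ¬ (∃[ v ] ∃[ J ]
      Branching v × v ∉ˢ J × (∀ {s} → Adj v s → s ∈ˢ J) × Biconnected J)
    biconnected-neighbourhood {z′} z′≢z k =
      minimal Part part₀ λ (D₁ , part , min₁) →
      let open Block part min₁ in
      -- Any vertex of `D` can serve as `v`; the witness of nonemptiness is taken.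
      minimal Lobe lobe₀ λ { (D , lobe@((v , v∈D) , _) , min₂) →
      let open InLobe lobe min₂ v∈D in
      k (v , J , branching₁ v∈D₁ , v∉J , neighbours∈J , J-biconnected) }
      where
      part₀ : Part (⊤ - z)
      part₀ = (z′ , x∈p∧x≢y⇒x∈p-y ∈⊤ z′≢z) , (λ z∈ → proj₂ (∈-minus⁻ z∈) refl) , z , bounded
        where
        bounded : Bounded (⊤ - z) z z
        bounded {w = w} _ _ w∉ with w ≟ z
        ... | yes w≡z = inj₁ w≡z
        ... | no w≢z = contradiction (x∈p∧x≢y⇒x∈p-y ∈⊤ w≢z) w∉

-- Lists without repetition.

Unique-resp-↭ : {xs ys : List A} → xs ↭ ys → Unique xs → Unique ys
Unique-resp-↭ {A = A} p = Permutation.Unique-resp-↭ (setoid A) (↭⇒↭ₛ p)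

Unique-++⁻ : (xs : List A) {ys : List A} → Unique (xs ++ ys) →
             Unique xs × Unique ys × Disjoint xs ys
Unique-++⁻ [] u = [] , u , λ ()
Unique-++⁻ (x ∷ xs) (x∉ ∷ u) with Unique-++⁻ xs u
... | uˡ , uʳ , disjoint = All-++⁻ˡ xs x∉ ∷ uˡ , uʳ , λ
  { (here refl , x∈ys) → All¬⇒¬Any (All-++⁻ʳ xs x∉) x∈ys
  ; (there x∈xs , x∈ys) → disjoint (x∈xs , x∈ys) }

Unique-∷ : {x : A} {xs : List A} → x ∉ xs → Unique xs → Unique (x ∷ xs)
Unique-∷ x∉ u = ¬Any⇒All¬ _ x∉ ∷ u

Unique-⊆-length : {xs ys : List A} → Unique xs →
                  (∀ {x} → x ∈ xs → x ∈ ys) → length xs ≤ length ys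
Unique-⊆-length {xs = []} _ _ = z≤n
Unique-⊆-length {xs = x ∷ xs} u@(_ ∷ u′) xs⊆ with ∈-∃++ (xs⊆ (here refl))
... | as , bs , refl =
  ≤-trans (s≤s (Unique-⊆-length u′ rest)) (≤-reflexive (sym (↭-length (shift x as bs))))
  where
  rest : ∀ {y} → y ∈ xs → y ∈ as ++ bs
  rest y∈ with ∈-resp-↭ (shift x as bs) (xs⊆ (there y∈))
  ... | here refl = contradiction y∈ (Unique[x∷xs]⇒x∉xs u)
  ... | there y∈′ = y∈′

-- A shared entry identifies the two lists, so a single `Unique` statement encodes all the
-- disjointness conditions of a subdivision.
concat-position : {x : A} (xss : List (List A)) → Unique (concat xss) → ∀ {k l} →
  x ∈ List.lookup xss k → x ∈ List.lookup xss l → k ≡ l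
concat-position (xs ∷ xss) u {zero} {zero} _ _ = refl
concat-position (xs ∷ xss) u {zero} {suc l} x∈k x∈l = ⊥-elim
  (proj₂ (proj₂ (Unique-++⁻ xs u)) (x∈k , ∈-concat⁺′ x∈l (∈-lookup {xs = xss} l)))
concat-position (xs ∷ xss) u {suc k} {zero} x∈k x∈l = ⊥-elim
  (proj₂ (proj₂ (Unique-++⁻ xs u)) (x∈l , ∈-concat⁺′ x∈k (∈-lookup {xs = xss} k)))
concat-position (xs ∷ xss) u {suc k} {suc l} x∈k x∈l =
  cong suc (concat-position xss (proj₁ (proj₂ (Unique-++⁻ xs u))) x∈k x∈l)

Unique-concat⁻ : (xss : List (List A)) → Unique (concat xss) → ∀ k → Unique (List.lookup xss k)
Unique-concat⁻ (xs ∷ xss) u zero = proj₁ (Unique-++⁻ xs u)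
Unique-concat⁻ (xs ∷ xss) u (suc k) = Unique-concat⁻ xss (proj₁ (proj₂ (Unique-++⁻ xs u))) k

-- Edges of the complete bipartite graph.

↑ˡ≢↑ʳ : ∀ {m k} (i : Fin m) (j : Fin k) → i ↑ˡ k ≢ m ↑ʳ j
↑ˡ≢↑ʳ {m} {k} i j eq with () ←
  trans (sym (splitAt-↑ˡ m i k)) (trans (cong (splitAt m) eq) (splitAt-↑ʳ m k j))

data BipartiteEdge a b : Fin (a ℕ.+ b) → Fin (a ℕ.+ b) → Set where
  across : ∀ i j → BipartiteEdge a b (i ↑ˡ b) (a ↑ʳ j)

-- An `Edge` is oriented upwards and the first class precedes the second, so an edge from the second
-- class to the first contradicts `u < v`.
bipartiteEdge : ∀ a b {u v} → Graph.Edge (K a b) u v → BipartiteEdge a b u v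
bipartiteEdge a b {u} {v} (u<v , u≁v) with splitAt a u in equ | splitAt a v in eqv
... | inj₁ i | inj₁ j = contradiction refl u≁v
... | inj₂ i | inj₂ j = contradiction refl u≁v
... | inj₁ i | inj₂ j with refl ← splitAt⁻¹-↑ˡ {i = u} equ | refl ← splitAt⁻¹-↑ʳ {i = v} eqv =
  across i j
... | inj₂ i | inj₁ j with refl ← splitAt⁻¹-↑ʳ {i = u} equ | refl ← splitAt⁻¹-↑ˡ {i = v} eqv =
  contradiction u<v (<⇒≯ (subst₂ ℕ._<_ (sym (toℕ-↑ˡ j b)) (sym (toℕ-↑ʳ a i))
    (<-≤-trans (toℕ<n j) (m≤m+n a _))))

-- Paths as chains.

module Routes (G : Graph n) where
  open Graph G renaming (sym to Adj-sym)
  open Walks G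

  infix 4 _∈?_
  _∈?_ : ∀ (x : Fin n) xs → Dec (x ∈ xs)
  _∈?_ = member? _≟_

  -- The list excludes both ends of the walk.
  data Chain : Fin n → List (Fin n) → Fin n → Set where
    edge : ∀ {a b} → Adj a b → Chain a [] b
    _∷_  : ∀ {a x xs b} → Adj a x → Chain x xs b → Chain a (x ∷ xs) b

  join : ∀ {a xs b ys c} → Chain a xs b → Chain b ys c → Chain a (xs ++ b ∷ ys) c
  join (edge e) d = e ∷ d
  join (e ∷ c) d = e ∷ join c d

  split : ∀ {a} xs {b ys c} → Chain a (xs ++ b ∷ ys) c → Chain a xs b × Chain b ys c
  split [] (e ∷ d) = edge e , d
  split (x ∷ xs) (e ∷ c) with split xs c
  ... | c₁ , c₂ = e ∷ c₁ , c₂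

  -- The new inner list is described only up to permutation, which preserves uniqueness and
  -- membership.
  flip : ∀ {a xs b} → Chain a xs b → ∃[ ys ] Chain b ys a × ys ↭ xs
  flip (edge e) = [] , edge (Adj-sym e) , ↭-refl
  flip {xs = x ∷ xs} (e ∷ c) with flip c
  ... | ys , d , p = ys ++ [ x ] , join d (edge (Adj-sym e)) , ↭-trans (++-comm ys [ x ]) (prep x p)

  linked : ∀ {a xs b} → Chain a xs b → Linked Adj (a ∷ xs ++ [ b ])
  linked (edge e) = e ∷ [-]
  linked (e ∷ c) = e ∷ linked c

  -- The walk is cut off at its first vertex in `T`, and loops are removed so that a path remains.
  firstHit : ∀ {J w a b} {T : Fin n → Set} → Decidable T → a ∈ˢ J × a ≢ w → ¬ T a →
    Star (Step J w) a b → T b → ∃[ xs ] ∃[ r ] Chain a xs r × T r × r ≢ w ×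
    Unique (a ∷ xs) × All (λ s → (s ∈ˢ J × s ≢ w) × ¬ T s) (a ∷ xs)
  firstHit T? a∈ ¬Ta ε Tb = contradiction Tb ¬Ta
  firstHit {a = a} T? a∈ ¬Ta (_◅_ {j = x} (e , x∈) rest) Tb with T? x
  ... | yes Tx = [] , x , edge e , Tx , proj₂ x∈ , [] ∷ [] , (a∈ , ¬Ta) ∷ []
  ... | no ¬Tx with firstHit T? x∈ ¬Tx rest Tb
  ...   | xs , r , c , Tr , r≢w , u , all with a ∈? x ∷ xs
  ...     | no a∉ = x ∷ xs , r , e ∷ c , Tr , r≢w , Unique-∷ a∉ u , (a∈ , ¬Ta) ∷ all
  -- `a` recurs on the path already found; only what follows the recurrence is kept.
  ...     | yes a∈xs with ∈-∃++ a∈xs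
  ...       | ys , zs , eq =
              zs , r
              , proj₂ (split ys (subst (λ l → Chain a l r) eq (e ∷ c)))
              , Tr , r≢w
              , proj₁ (proj₂ (Unique-++⁻ ys (subst Unique eq u)))
              , All-++⁻ʳ ys (subst (All _) eq all)

  -- Ears of a 2-connected graph.

  module Fan {J : Subset n} (biconnected : Biconnected J) (U : List (Fin n))
             (U⊆J : ∀ {s} → s ∈ U → s ∈ˢ J) where

    Inner : Fin n → Set
    Inner s = s ∈ˢ J × s ∉ U

    -- Equivalently, two paths from `u` to different vertices of `U` that meet only in `u`: a fan of
    -- size two.
    record Ear (u : Fin n) : Set where
      constructor ear
      field
        {p q}  : Fin n
        {inner} : List (Fin n)
        p∈U    : p ∈ U
        q∈U    : q ∈ U
        p≢q    : p ≢ q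
        chain  : Chain p inner q
        unique : Unique inner
        inside : All Inner inner
        u∈     : u ∈ inner

    -- An ear through s is turned into one through x by leaving it at s along R,
    -- which returns to U or to the second half of the ear at r.
    reroute : ∀ {p q s r x M₁ M₂ R} → p ∈ U → q ∈ U → p ≢ q →
      Chain p M₁ s → Chain s M₂ q → Unique (M₁ ++ s ∷ M₂) → All Inner (M₁ ++ s ∷ M₂) →
      Chain s R r → Unique R → All Inner R → Disjoint R (M₁ ++ s ∷ M₂) → x ∈ R →
      (r ∈ U × p ≢ r) ⊎ r ∈ M₂ → Ear x
    reroute {p} {q} {s} {r} {x} {M₁} {M₂} {R} p∈U q∈U p≢q c₁ c₂ uM inM d uR inR disj x∈R target =
      finish target
      where
      N : List (Fin n)
      N = M₁ ++ s ∷ R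
      rearrange : R ++ (M₁ ++ s ∷ M₂) ↭ N ++ M₂
      rearrange = ↭-trans (shifts R M₁) (↭-trans (++⁺ˡ M₁ (shift s R M₂))
        (↭-reflexive (sym (++-assoc M₁ (s ∷ R) M₂))))
      uW : Unique (N ++ M₂)
      uW = Unique-resp-↭ rearrange (Unique-++⁺ uR uM disj)
      inW : All Inner (N ++ M₂)
      inW = All-resp-↭ rearrange (All-++⁺ inR inM)
      x∈N : x ∈ N
      x∈N = ∈-++⁺ʳ M₁ (there x∈R)
      finish : (r ∈ U × p ≢ r) ⊎ r ∈ M₂ → Ear x
      finish (inj₁ (r∈U , p≢r)) =
        ear p∈U r∈U p≢r (join c₁ d) (proj₁ (Unique-++⁻ N uW)) (All-++⁻ˡ N inW) x∈N
      finish (inj₂ r∈M₂) with ∈-∃++ r∈M₂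
      ... | X , Y , refl with Unique-++⁻ N uW
      ...   | uN , uM₂ , dis =
        ear p∈U q∈U p≢q (join (join c₁ d) (proj₂ (split X c₂)))
          (Unique-++⁺ uN (proj₁ (proj₂ (Unique-++⁻ X uM₂))) λ (i , j) → dis (i , ∈-++⁺ʳ X j))
          (All-++⁺ (All-++⁻ˡ N inW) (All-++⁻ʳ X (All-++⁻ʳ N inW)))
          (∈-++⁺ˡ x∈N)

    module _ {u₀ u₁} (u₀∈U : u₀ ∈ U) (u₁∈U : u₁ ∈ U) (u₀≢u₁ : u₀ ≢ u₁) where

      other : ∀ s → ∃[ u ] u ∈ U × u ≢ s
      other s with u₀ ≟ s
      ... | no u₀≢s = u₀ , u₀∈U , u₀≢s
      ... | yes refl = u₁ , u₁∈U , ≢-sym u₀≢u₁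

      Reached : Fin n → Set
      Reached s = s ∈ U ⊎ Ear s

      -- A walk from `x` back to `U` that avoids `s` first meets `U` or the old ear in a vertex
      -- other than `s`. It thus completes an ear starting at `s`, if `s` is in `U`, or reroutes the
      -- ear through `s`.
      advance : ∀ {s x} → Reached s → Adj s x → x ∈ˢ J → ¬ ¬ Reached x
      advance {s} {x} reached e x∈J k with x ∈? U
      ... | yes x∈U = k (inj₁ x∈U)
      advance {s} {x} (inj₁ s∈U) e x∈J k | no x∉U with other s
      ... | u , u∈U , u≢s =
        biconnected s x∈J (U⊆J u∈U) x≢s u≢s λ walk →
        let (R , r , c , r∈U , r≢s , uR , all) = firstHit (_∈? U) (x∈J , x≢s) x∉U walk u∈U in
        k (inj₂ (ear s∈U r∈U (≢-sym r≢s) (e ∷ c) uR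
                     (All.map (λ ((i , _) , o) → i , o) all) (here refl)))
        where
        x≢s : x ≢ s
        x≢s refl = irrefl refl e
      advance {s} {x} (inj₂ E) e x∈J k | no x∉U with x ∈? Ear.inner E
      ... | yes x∈ = k (inj₂ (record { Ear E ; u∈ = x∈ }))
      ... | no x∉ with ∈-∃++ (Ear.u∈ E)
      ...   | M₁ , M₂ , refl =
        biconnected s x∈J (U⊆J p∈U) x≢s p≢s λ walk →
        let (R , r , c , r∈ , r≢s , uR , all) =
              firstHit (_∈? U ++ M₁ ++ s ∷ M₂) (x∈J , x≢s)
                ([ x∉U , x∉ ]′ ∘ ∈-++⁻ U) walk (∈-++⁺ˡ p∈U)
            (M₂′ , c₂′ , perm₂) = flip (proj₂ (split M₁ chain))
            (M₁′ , c₁′ , perm₁) = flip (proj₁ (split M₁ chain))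
            perm = reversed perm₁ perm₂
            inR = All.map (λ ((i , _) , o) → i , o ∘ ∈-++⁺ˡ) all
            disjoint : Disjoint (x ∷ R) (M₁ ++ s ∷ M₂)
            disjoint = λ (i , j) → proj₂ (lookup all i) (∈-++⁺ʳ U j)
            forward = reroute p∈U q∈U p≢q (proj₁ (split M₁ chain)) (proj₂ (split M₁ chain))
              unique inside (e ∷ c) uR inR disjoint (here refl)
            backward = reroute q∈U p∈U (≢-sym p≢q) c₂′ c₁′
              (Unique-resp-↭ (↭-sym perm) unique) (All-resp-↭ (↭-sym perm) inside)
              (e ∷ c) uR inR (λ (i , j) → disjoint (i , ∈-resp-↭ perm j)) (here refl)
        in k (inj₂ (direct forward backward (∈-resp-↭ (↭-sym perm₁)) r≢s (∈-++⁻ U r∈)))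
        where
        open Ear E
        x≢s : x ≢ s
        x≢s refl = irrefl refl e
        p≢s : p ≢ s
        p≢s refl = proj₂ (lookup inside u∈) p∈U
        reversed : ∀ {M₁′ M₂′} → M₁′ ↭ M₁ → M₂′ ↭ M₂ → M₂′ ++ s ∷ M₁′ ↭ M₁ ++ s ∷ M₂
        reversed {M₁′} {M₂′} perm₁ perm₂ =
          ↭-trans (shift s M₂′ M₁′) (↭-trans (prep s (↭-trans (++-comm M₂′ M₁′) (++⁺ perm₁ perm₂)))
            (↭-sym (shift s M₁ M₂)))
        -- The new ear starts at `p`, unless the walk returns to `p` or to the part of the ear
        -- between `p` and `s`; then it starts at `q`.
        direct : ∀ {r M₁′} → ((r ∈ U × p ≢ r) ⊎ r ∈ M₂ → Ear x) →
          ((r ∈ U × q ≢ r) ⊎ r ∈ M₁′ → Ear x) → (r ∈ M₁ → r ∈ M₁′) → r ≢ s →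
          r ∈ U ⊎ r ∈ M₁ ++ s ∷ M₂ → Ear x
        direct {r} forward backward flipped r≢s (inj₁ r∈U) with p ≟ r
        ... | no p≢r = forward (inj₁ (r∈U , p≢r))
        ... | yes refl = backward (inj₁ (r∈U , ≢-sym p≢q))
        direct forward backward flipped r≢s (inj₂ r∈M) with ∈-++⁻ M₁ r∈M
        ... | inj₁ r∈M₁ = backward (inj₂ (flipped r∈M₁))
        ... | inj₂ (here r≡s) = contradiction r≡s r≢s
        ... | inj₂ (there r∈M₂) = forward (inj₂ r∈M₂)

      advance* : ∀ {s u w} → Reached s → Star (Step J w) s u → ¬ ¬ Reached u
      advance* reached ε k = k reached
      advance* reached ((e , x∈J , _) ◅ walk) k =
        advance reached e x∈J λ reached′ → advance* reached′ walk k

      ear-through : ∀ {u} → u ∈ˢ J → u ∉ U → ¬ ¬ Ear u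
      ear-through u∈J u∉U k =
        -- `Biconnected` asks for a vertex to avoid that differs from both ends of the walk; `u₁` is
        -- one.
        biconnected u₁ (U⊆J u₀∈U) u∈J u₀≢u₁ (λ { refl → u∉U u₁∈U }) λ walk →
        advance* (inj₁ u₀∈U) walk [ u∉U , k ]′

  -- Assembling a subdivision of `K 3 3`.

  module _ {p q v a b c : Fin n} {A₁ A₂ B₁ B₂ M₁ M₂ : List (Fin n)}
    (pa : Chain p A₁ a) (qa : Chain q A₂ a) (pb : Chain p B₁ b) (qb : Chain q B₂ b)
    (pc : Chain p M₁ c) (qc : Chain q M₂ c) (va : Adj v a) (vb : Adj v b) (vc : Adj v c) where

    private
      -- The branch vertices in the order of Fin 6, then the segments in the order
      -- given by combine.
      pieces : List (List (Fin n))
      pieces = [ p ] ∷ [ q ] ∷ [ v ] ∷ [ a ] ∷ [ b ] ∷ [ c ] ∷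
               A₁ ∷ B₁ ∷ M₁ ∷ A₂ ∷ B₂ ∷ M₂ ∷ [] ∷ [] ∷ [] ∷ []

      branch : Fin 6 → Fin n
      branch = Vec.lookup (p ∷ q ∷ v ∷ a ∷ b ∷ c ∷ [])

      segment : Fin 3 → Fin 3 → List (Fin n)
      segment i j = List.lookup pieces (6 ↑ʳ combine i j)

      -- Pairs that do not lead from the first class to the second get the empty list as a default.
      inner : Fin 6 → Fin 6 → List (Fin n)
      inner u w =
        [ (λ i → [ (λ _ → []) , segment i ]′ (splitAt 3 w)) , (λ _ → []) ]′ (splitAt 3 u)

      inner≡segment : ∀ i j → inner (i ↑ˡ 3) (3 ↑ʳ j) ≡ segment i j
      inner≡segment i j rewrite splitAt-↑ˡ 3 i 3 | splitAt-↑ʳ 3 3 j = refl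

      branch∈ : ∀ w → branch w ∈ List.lookup pieces (w ↑ˡ 9)
      branch∈ 0F = here refl
      branch∈ 1F = here refl
      branch∈ 2F = here refl
      branch∈ 3F = here refl
      branch∈ 4F = here refl
      branch∈ 5F = here refl

      chain : ∀ i j → Chain (branch (i ↑ˡ 3)) (segment i j) (branch (3 ↑ʳ j))
      chain 0F 0F = pa
      chain 0F 1F = pb
      chain 0F 2F = pc
      chain 1F 0F = qa
      chain 1F 1F = qb
      chain 1F 2F = qc
      chain 2F 0F = edge va
      chain 2F 1F = edge vb
      chain 2F 2F = edge vc

    -- Injectivity and disjointness hold because a vertex has only one position in `pieces`, where
    -- the branch vertices are the six singletons at the front.
    K₃₃-subdivision : Unique (concat pieces) → Subdivision (K 3 3) G
    K₃₃-subdivision unique = record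
      { branch = branch
      ; branch-injective = branch-injective
      ; inner = inner
      ; isPath = isPath ∘ bipartiteEdge 3 3
      ; inner-not-branch = inner-not-branch ∘ bipartiteEdge 3 3
      ; inner-disjoint = λ e e′ → inner-disjoint (bipartiteEdge 3 3 e) (bipartiteEdge 3 3 e′)
      }
      where
      position : ∀ {x k l} → x ∈ List.lookup pieces k → x ∈ List.lookup pieces l → k ≡ l
      position = concat-position pieces unique

      branch-injective : ∀ {u w} → branch u ≡ branch w → u ≡ w
      branch-injective {u} {w} eq = ↑ˡ-injective 9 u w
        (position (branch∈ u) (subst (_∈ List.lookup pieces (w ↑ˡ 9)) (sym eq) (branch∈ w)))

      branch∉segment : ∀ w i j → branch w ∉ segment i j
      branch∉segment w i j w∈ = ↑ˡ≢↑ʳ w (combine i j) (position (branch∈ w) w∈)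

      isPath : ∀ {u w} → BipartiteEdge 3 3 u w → IsPath (branch u ∷ inner u w ++ [ branch w ])
      isPath (across i j) rewrite inner≡segment i j =
        Unique-∷ ([ branch∉segment (i ↑ˡ 3) i j
                  , (λ { (here eq) → ↑ˡ≢↑ʳ i j (branch-injective eq) }) ]′
                  ∘ ∈-++⁻ (segment i j))
          (Unique-++⁺ (Unique-concat⁻ pieces unique (6 ↑ʳ combine i j)) ([] ∷ [])
            λ { (x∈ , here refl) → branch∉segment (3 ↑ʳ j) i j x∈ })
        , linked (chain i j)

      inner-not-branch : ∀ {u w} → BipartiteEdge 3 3 u w → ∀ z → branch z ∉ inner u w
      inner-not-branch (across i j) z rewrite inner≡segment i j = branch∉segment z i j

      inner-disjoint : ∀ {u w u′ w′} → BipartiteEdge 3 3 u w → BipartiteEdge 3 3 u′ w′ →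
                       (u , w) ≢ (u′ , w′) → Disjoint (inner u w) (inner u′ w′)
      inner-disjoint (across i j) (across i′ j′) ne (x∈ , x∈′)
        rewrite inner≡segment i j | inner≡segment i′ j′
        with refl , refl ← combine-injective i j i′ j′
               (↑ʳ-injective 6 (combine i j) (combine i′ j′) (position x∈ x∈′))
        = ne refl

  -- Arcs of a cycle.

  rotate : ∀ {x xs p} → Chain x xs x → p ∈ x ∷ xs → ∃[ ys ] Chain p ys p × p ∷ ys ↭ x ∷ xs
  rotate c (here refl) = _ , c , ↭-refl
  rotate {x} {p = p} c (there p∈) with ∈-∃++ p∈
  ... | ys , zs , refl with split ys c
  ...   | c₁ , c₂ = zs ++ x ∷ ys , join c₂ c₁ , ++-comm (p ∷ zs) (x ∷ ys)

  arcs : ∀ {x xs p q} → Chain x xs x → p ∈ x ∷ xs → q ∈ x ∷ xs → p ≢ q →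
         ∃₂ λ A B → Chain p A q × Chain q B p × p ∷ A ++ q ∷ B ↭ x ∷ xs
  arcs c p∈ q∈ p≢q with rotate c p∈
  ... | ys , c′ , perm with ∈-resp-↭ (↭-sym perm) q∈
  ...   | here refl = contradiction refl p≢q
  ...   | there q∈ys with ∈-∃++ q∈ys
  ...     | A , B , refl = A , B , proj₁ (split A c′) , proj₂ (split A c′) , perm

  -- A wheel or a subdivision around a hub.

  module Hub (wheelFree : WheelFree) (noK₃₃ : ¬ Subdivision (K 3 3) G) {v : Fin n} where

    module ↭-Solver = Solver (++-commutativeMonoid {A = Fin n})
    open ↭-Solver using (solve; _⊕_; _⊜_)

    -- The three paths between `p` and `q` are cut at `a`, `b` and `c`, and the second halves are
    -- flipped so that all six segments start at `p` or `q`. The edges at `v` supply the other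
    -- three.
    cross : ∀ {a b c p q A B M} → Adj v a → Adj v b → Adj v c →
      Chain p A q → Chain q B p → Chain p M q →
      Unique ((p ∷ A ++ q ∷ B) ++ M) → v ∉ (p ∷ A ++ q ∷ B) ++ M →
      a ∈ A → b ∈ B → c ∈ M → ⊥
    cross {a} {b} {c} {p} {q} va vb vc cA cB cM u v∉ a∈ b∈ c∈
      with ∈-∃++ a∈ | ∈-∃++ b∈ | ∈-∃++ c∈
    ... | A₁ , A₂ , refl | B₁ , B₂ , refl | M₁ , M₂ , refl
      with split A₁ cA | split B₁ cB | split M₁ cM
    ...   | pa , aq | qb , bp | pc , cq with flip aq | flip bp | flip cq
    ...     | A₂′ , qa , permA | B₂′ , pb , permB | M₂′ , qc , permM =
      noK₃₃ (K₃₃-subdivision pa qa pb qb pc qc va vb vc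
        (Unique-resp-↭ rearrange (Unique-∷ v∉ u)))
      where
      rearrange : v ∷ (p ∷ (A₁ ++ a ∷ A₂) ++ q ∷ B₁ ++ b ∷ B₂) ++ M₁ ++ c ∷ M₂
                  ↭ p ∷ q ∷ v ∷ a ∷ b ∷ c ∷ A₁ ++ B₂′ ++ M₁ ++ A₂′ ++ B₁ ++ M₂′ ++ []
      rearrange = ↭-trans
        (solve 12 (λ p q v a b c A₁ A₂ B₁ B₂ M₁ M₂ →
            v ⊕ (p ⊕ (A₁ ⊕ a ⊕ A₂) ⊕ q ⊕ B₁ ⊕ b ⊕ B₂) ⊕ M₁ ⊕ c ⊕ M₂
          ⊜ p ⊕ q ⊕ v ⊕ a ⊕ b ⊕ c ⊕ A₁ ⊕ B₂ ⊕ M₁ ⊕ A₂ ⊕ B₁ ⊕ M₂ ⊕ ↭-Solver.id)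
          ↭-refl [ p ] [ q ] [ v ] [ a ] [ b ] [ c ] A₁ A₂ B₁ B₂ M₁ M₂)
        (++⁺ˡ (p ∷ q ∷ v ∷ a ∷ b ∷ c ∷ A₁) (++⁺ (↭-sym permB)
          (++⁺ˡ M₁ (++⁺ (↭-sym permA) (++⁺ˡ B₁ (++⁺ʳ [] (↭-sym permM)))))))

    module _ {a b c : Fin n} (distinct : a ≢ b × a ≢ c × b ≢ c)
             (va : Adj v a) (vb : Adj v b) (vc : Adj v c) where

      no-wheel : ∀ {x xs} → Chain x xs x → Unique (x ∷ xs) → v ∉ x ∷ xs →
                 a ∈ x ∷ xs → b ∈ x ∷ xs → c ∈ x ∷ xs → ⊥
      no-wheel {x} {xs} chain u v∉ a∈ b∈ c∈ =
        wheelFree (v , x , xs ,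
          -- The rim has length at least 3 because it contains three neighbours of `v`.
          (≤-trans three (length-filter (adj? v) (x ∷ xs)) , u , linked chain) , v∉ , three)
        where
        spokes : ∀ {y} → y ∈ a ∷ b ∷ c ∷ [] → y ∈ filter (adj? v) (x ∷ xs)
        spokes (here refl) = ∈-filter⁺ (adj? v) a∈ va
        spokes (there (here refl)) = ∈-filter⁺ (adj? v) b∈ vb
        spokes (there (there (here refl))) = ∈-filter⁺ (adj? v) c∈ vc
        three : 3 ≤ #neighboursIn v (x ∷ xs)
        three = let (a≢b , a≢c , b≢c) = distinct in
          Unique-⊆-length ((a≢b ∷ a≢c ∷ []) ∷ (b≢c ∷ []) ∷ [] ∷ []) spokes

      -- The arc `B` is discarded, and `A` and `M` close up to the rim.
      lens : ∀ {p q A B M} → Chain p A q → Chain q M p →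
        Unique ((p ∷ A ++ q ∷ B) ++ M) → v ∉ (p ∷ A ++ q ∷ B) ++ M →
        a ∈ p ∷ q ∷ A → b ∈ p ∷ q ∷ A → c ∈ M → ⊥
      lens {p} {q} {A} {B} {M} cA cM u v∉ a∈ b∈ c∈ =
        no-wheel (join cA cM)
          (proj₁ (proj₂ (Unique-++⁻ B (Unique-resp-↭ rearrange u))))
          (v∉ ∘ ∈-resp-↭ (↭-sym rearrange) ∘ ∈-++⁺ʳ B)
          (onCycle a∈) (onCycle b∈) (there (∈-++⁺ʳ A (there c∈)))
        where
        rearrange : (p ∷ A ++ q ∷ B) ++ M ↭ B ++ p ∷ A ++ q ∷ M
        rearrange = solve 5 (λ p q A B M →
          (p ⊕ A ⊕ q ⊕ B) ⊕ M ⊜ B ⊕ p ⊕ A ⊕ q ⊕ M) ↭-refl [ p ] [ q ] A B M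
        onCycle : ∀ {y} → y ∈ p ∷ q ∷ A → y ∈ p ∷ A ++ q ∷ M
        onCycle (here refl) = here refl
        onCycle (there (here refl)) = there (∈-insert A)
        onCycle (there (there y∈)) = there (∈-++⁺ˡ y∈)

      theta : ∀ {p q A B M} → Chain p A q → Chain q B p → Chain p M q →
        Unique ((p ∷ A ++ q ∷ B) ++ M) → v ∉ (p ∷ A ++ q ∷ B) ++ M →
        a ∈ p ∷ A ++ q ∷ B → b ∈ p ∷ A ++ q ∷ B → c ∈ M → ⊥
      theta {p} {q} {A} {B} {M} cA cB cM u v∉ a∈ b∈ c∈ = cases (locate a∈) (locate b∈)
        where
        Place : Fin n → Set
        Place y = y ∈ p ∷ q ∷ [] ⊎ y ∈ A ⊎ y ∈ B
        locate : ∀ {y} → y ∈ p ∷ A ++ q ∷ B → Place y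
        locate (here refl) = inj₁ (here refl)
        locate (there y∈) with ∈-++⁻ A y∈
        ... | inj₁ y∈A = inj₂ (inj₁ y∈A)
        ... | inj₂ (here refl) = inj₁ (there (here refl))
        ... | inj₂ (there y∈B) = inj₂ (inj₂ y∈B)
        -- `A` and `M` both run from `p` to `q`, so `M` has to be reversed here; with `B`, which
        -- runs from `q` to `p`, it need not be.
        on₁ : a ∈ p ∷ q ∷ A → b ∈ p ∷ q ∷ A → ⊥
        on₁ a∈ b∈ with flip cM
        ... | M′ , cM′ , perm =
          lens cA cM′ (Unique-resp-↭ perm′ u) (v∉ ∘ ∈-resp-↭ (↭-sym perm′)) a∈ b∈
            (∈-resp-↭ (↭-sym perm) c∈)
          where
          perm′ : (p ∷ A ++ q ∷ B) ++ M ↭ (p ∷ A ++ q ∷ B) ++ M′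
          perm′ = ++⁺ˡ (p ∷ A ++ q ∷ B) (↭-sym perm)
        on₂ : a ∈ q ∷ p ∷ B → b ∈ q ∷ p ∷ B → ⊥
        on₂ a∈ b∈ = lens cB cM (Unique-resp-↭ perm′ u) (v∉ ∘ ∈-resp-↭ (↭-sym perm′)) a∈ b∈ c∈
          where
          perm′ : (p ∷ A ++ q ∷ B) ++ M ↭ (q ∷ B ++ p ∷ A) ++ M
          perm′ = ++⁺ʳ M (++-comm (p ∷ A) (q ∷ B))
        end₁ : ∀ {y} → y ∈ p ∷ q ∷ [] → y ∈ p ∷ q ∷ A
        end₁ = ∈-++⁺ˡ
        end₂ : ∀ {y} → y ∈ p ∷ q ∷ [] → y ∈ q ∷ p ∷ B
        end₂ (here refl) = there (here refl)
        end₂ (there (here refl)) = here refl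
        arc : ∀ {y x x′ xs} → y ∈ xs → y ∈ x ∷ x′ ∷ xs
        arc y∈ = there (there y∈)
        cases : Place a → Place b → ⊥
        cases (inj₁ a∈) (inj₁ b∈) = on₁ (end₁ a∈) (end₁ b∈)
        cases (inj₁ a∈) (inj₂ (inj₁ b∈)) = on₁ (end₁ a∈) (arc b∈)
        cases (inj₁ a∈) (inj₂ (inj₂ b∈)) = on₂ (end₂ a∈) (arc b∈)
        cases (inj₂ (inj₁ a∈)) (inj₁ b∈) = on₁ (arc a∈) (end₁ b∈)
        cases (inj₂ (inj₂ a∈)) (inj₁ b∈) = on₂ (arc a∈) (end₂ b∈)
        cases (inj₂ (inj₁ a∈)) (inj₂ (inj₁ b∈)) = on₁ (arc a∈) (arc b∈)
        cases (inj₂ (inj₂ a∈)) (inj₂ (inj₂ b∈)) = on₂ (arc a∈) (arc b∈)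
        cases (inj₂ (inj₁ a∈)) (inj₂ (inj₂ b∈)) = cross va vb vc cA cB cM u v∉ a∈ b∈ c∈
        cases (inj₂ (inj₂ a∈)) (inj₂ (inj₁ b∈)) = cross vb va vc cA cB cM u v∉ b∈ a∈ c∈

    no-biconnected-neighbourhood : ∀ {J} → Branching v → v ∉ˢ J →
      (∀ {s} → Adj v s → s ∈ˢ J) → ¬ Biconnected J
    no-biconnected-neighbourhood {J} (a , b , c , distinct@(a≢b , a≢c , b≢c) , va , vb , vc)
      v∉J nbrs∈J biconnected =
      -- The walk from `a` to `c` avoiding `b` is used for its first step, which yields a neighbour
      -- of `a` in `J` other than `b`.
      biconnected b (nbrs∈J va) (nbrs∈J vc) a≢b (≢-sym b≢c) first-step
      where
      onCycle : ∀ {x xs} → Chain x xs x → Unique (x ∷ xs) → (∀ {s} → s ∈ x ∷ xs → s ∈ˢ J) →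
                a ∈ x ∷ xs → b ∈ x ∷ xs → ⊥
      onCycle {x} {xs} cycle u ⊆J a∈ b∈ with c ∈? x ∷ xs
      ... | yes c∈ = no-wheel distinct va vb vc cycle u (v∉J ∘ ⊆J) a∈ b∈ c∈
      -- `a` and `b` serve as the two different vertices of the cycle that `ear-through` needs.
      ... | no c∉ = ear-through a∈ b∈ a≢b (nbrs∈J vc) c∉ λ E →
        let open Ear E
            (A , B , cA , cB , perm) = arcs cycle p∈U q∈U p≢q
            onRim : ∀ {s} → s ∈ _ → s ∈ x ∷ xs
            onRim = ∈-resp-↭ perm
        in theta distinct va vb vc cA cB chain
             (Unique-++⁺ (Unique-resp-↭ (↭-sym perm) u) unique
               λ (i , j) → proj₂ (lookup inside j) (onRim i))
             ([ v∉J ∘ ⊆J ∘ onRim , v∉J ∘ proj₁ ∘ lookup inside ]′ ∘ ∈-++⁻ _)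
             (∈-resp-↭ (↭-sym perm) a∈) (∈-resp-↭ (↭-sym perm) b∈) u∈
        where open Fan biconnected (x ∷ xs) ⊆J

      -- A neighbour a′ ≢ b of a closes up an ear through b with ends a and a′.
      first-step : ¬ Star (Step J b) a c
      first-step ε = a≢c refl
      first-step (_◅_ {j = a′} (aa′ , a′∈J , a′≢b) _) =
        ear-through (here refl) (there (here refl)) a≢a′ (nbrs∈J vb) b∉ through
        where
        U⊆J : ∀ {s} → s ∈ a ∷ a′ ∷ [] → s ∈ˢ J
        U⊆J (here refl) = nbrs∈J va
        U⊆J (there (here refl)) = a′∈J
        open Fan biconnected (a ∷ a′ ∷ []) U⊆J
        a≢a′ : a ≢ a′
        a≢a′ refl = irrefl refl aa′
        b∉ : b ∉ a ∷ a′ ∷ []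
        b∉ (here refl) = a≢b refl
        b∉ (there (here refl)) = a′≢b refl
        closing : ∀ {p q} → p ∈ a ∷ a′ ∷ [] → q ∈ a ∷ a′ ∷ [] → p ≢ q → Adj q p × (p ≡ a ⊎ q ≡ a)
        closing (here refl) (here refl) p≢q = contradiction refl p≢q
        closing (here refl) (there (here refl)) _ = Adj-sym aa′ , inj₁ refl
        closing (there (here refl)) (here refl) _ = aa′ , inj₂ refl
        closing (there (here refl)) (there (here refl)) p≢q = contradiction refl p≢q
        through : ¬ Ear b
        through E = onCycle (join chain (edge qp)) unique-cycle ⊆J a∈ (there (∈-++⁺ˡ u∈))
          where
          open Ear E
          qp : Adj q p
          qp = proj₁ (closing p∈U q∈U p≢q)
          outside : ∀ {s} → s ∈ inner → s ∉ a ∷ a′ ∷ []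
          outside = proj₂ ∘ lookup inside
          unique-cycle : Unique (p ∷ inner ++ [ q ])
          unique-cycle = Unique-∷
            ([ (λ p∈ → outside p∈ p∈U) , (λ { (here p≡q) → p≢q p≡q }) ]′ ∘ ∈-++⁻ inner)
            (Unique-++⁺ unique ([] ∷ []) λ { (q∈ , here refl) → outside q∈ q∈U })
          ⊆J : ∀ {s} → s ∈ p ∷ inner ++ [ q ] → s ∈ˢ J
          ⊆J (here refl) = U⊆J p∈U
          ⊆J (there s∈) with ∈-++⁻ inner s∈
          ... | inj₁ s∈inner = proj₁ (lookup inside s∈inner)
          ... | inj₂ (here refl) = U⊆J q∈U
          a∈ : a ∈ p ∷ inner ++ [ q ]
          a∈ with proj₂ (closing p∈U q∈U p≢q)
          ... | inj₁ refl = here refl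
          ... | inj₂ refl = there (∈-insert inner)

  -- Degrees and the conclusion.

  3≤degree⇒branching : ∀ {v} → 3 ≤ degree v → Branching v
  3≤degree⇒branching {v} 3≤ =
    pick (filter (adj? v) (allFin n)) 3≤ (filter⁺ (adj? v) (allFin⁺ n))
      (proj₂ ∘ ∈-filter⁻ (adj? v) {xs = allFin n})
    where
    pick : ∀ xs → 3 ≤ length xs → Unique xs → (∀ {x} → x ∈ xs → Adj v x) → Branching v
    pick (a ∷ b ∷ c ∷ _) _ ((a≢b ∷ a≢c ∷ _) ∷ (b≢c ∷ _) ∷ _) adj =
      a , b , c , (a≢b , a≢c , b≢c) ,
      adj (here refl) , adj (there (here refl)) , adj (there (there (here refl)))
    pick (_ ∷ []) (s≤s ())
    pick (_ ∷ _ ∷ []) (s≤s (s≤s ()))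

theorem4p9 : ∀ {n : ℕ} (G : Graph n) → 2 ≤ n →
    Graph.WheelFree G → ¬ Subdivision (K 3 3) G →
    ∃[ u ] ∃[ v ] (u ≢ v × Graph.degree G u ≤ 2 × Graph.degree G v ≤ 2)
theorem4p9 {suc (suc n)} G (s≤s (s≤s z≤n)) wheelFree noK₃₃ =
  -- The conclusion is decidable, so refuting its negation suffices, and the doubly negated lemmas
  -- can be used.
  decidable-stable (any? λ u → any? λ v → ¬? (u ≟ v) ×-dec low? u ×-dec low? v) λ none →
  let (z , z′ , z′≢z , only) = exception none in
  Walks.biconnected-neighbourhood G (λ u≢z → 3≤degree⇒branching (≰⇒> (only u≢z))) z′≢z
    λ (v , J , branching , v∉J , nbrs∈J , biconnected) →
    Hub.no-biconnected-neighbourhood wheelFree noK₃₃ branching v∉J nbrs∈J biconnected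
  where
  open Graph G using (degree)
  open Routes G
  low? : ∀ u → Dec (degree u ≤ 2)
  low? u = degree u ≤? 2
  different : ∀ (z : Fin (suc (suc n))) → ∃[ z′ ] z′ ≢ z
  different zero = 1F , λ ()
  different (suc z) = 0F , λ ()
  exception : ¬ (∃[ u ] ∃[ v ] (u ≢ v × degree u ≤ 2 × degree v ≤ 2)) →
    ∃[ z ] ∃[ z′ ] z′ ≢ z × (∀ {u} → u ≢ z → ¬ degree u ≤ 2)
  exception none with any? low?
  -- No vertex has low degree, so any vertex can play the exceptional `z`.
  ... | no all-high = 0F , 1F , (λ ()) , λ _ low → all-high (_ , low)
  ... | yes (z , low) = z , proj₁ (different z) , proj₂ (different z) ,
    λ u≢z low′ → none (_ , _ , u≢z , low′ , low)
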